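{- Let $\alpha\in[1/2,1]$ and $K\ge2$. For each element $e_i\in E$ let $\hat c_{i1}\ge\dots\ge\hat c_{iK}$ be the costs $c_{i1},\dots,c_{iK}$ in nonincreasing order, let $\hat c_i=\alpha\hat c_{i1}+(1-\alpha)\hat c_{i2}$, and let $\hat X\in\Phi$ minimize $\hat C(X)=\sum_{e_i\in X}\hat c_i$ over $X\in\Phi$. Then for any $X\in\Phi$ $$\mathrm{OWA}(\hat X)\le[\alpha K+(1-\alpha)(K-2)]\,\mathrm{OWA}(X),$$ where $\mathrm{OWA}(X)=\alpha\max_{1\le j\le K}F(X,\pmb{c}_j)+(1-\alpha)\min_{1\le j\le K}F(X,\pmb{c}_j)$ is the Hurwicz criterion.
   Context: $E=\{e_1,\dots,e_n\}$ is a finite set of elements, $\Phi\subseteq2^E$ is a (nonempty) set of feasible solutions, and $\Gamma=\{\pmb{c}_1,\dots,\pmb{c}_K\}$ is a scenario set of $K$ distinct cost scenarios $\pmb{c}_j=(c_{1j},\dots,c_{nj})$ with nonnegative entries. For $X\in\Phi$, $F(X,\pmb{c}_j)=\sum_{e_i\in X}c_{ij}$. -}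

module Defs where

open import Algebra.Bundles using (CommutativeRing; Semiring)
open import Data.Bool.Base using (if_then_else_)
open import Data.Fin.Base as Fin using (Fin)
open import Data.Fin.Patterns using (0F; 1F)
open import Data.Fin.Subset using (Subset)
open import Data.Fin.Subset.Properties using (_∈?_)
open import Data.List.Base as List using ()
open import Data.Nat.Base as ℕ using (ℕ)
open import Data.Product.Base using (_×_)
open import Data.Sum.Base using (inj₁; inj₂)
open import Data.Vec.Functional using (Vector; head; tail)
open import Data.Vec.Functional.Relation.Binary.Permutation using (_↭_)
open import Level using (Level; _⊔_) renaming (suc to lsuc)
open import Relation.Binary.Bundles using (TotalOrder)
open import Relation.Binary.Core using (Rel)
open import Relation.Binary.PropositionalEquality.Core using (_≡_)
open import Relation.Binary.Structures using (IsTotalOrder)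
open import Relation.Nullary.Decidable.Core using (does)
open import Relation.Nullary.Negation.Core using (¬_)
open import Relation.Unary using (Pred; Satisfiable)
import Algebra.Definitions.RawSemiring as RawSemiringDefs
import Algebra.Properties.Ring as RingProperties
import Data.List.Extrema as Extrema

-- The library has no real numbers, so costs and weights live in an arbitrary
-- linearly ordered field, of which the classical ℝ is an instance.
record OrderedField (c ℓ₁ ℓ₂ : Level) : Set (lsuc (c ⊔ ℓ₁ ⊔ ℓ₂)) where
  infix 4 _≤_
  field
    commutativeRing : CommutativeRing c ℓ₁

  open CommutativeRing commutativeRing public

  field
    _≤_          : Rel Carrier ℓ₂
    isTotalOrder : IsTotalOrder _≈_ _≤_
    +-monoʳ-≤    : ∀ x {y z} → y ≤ z → x + y ≤ x + z
    *-nonneg     : ∀ {x y} → 0# ≤ x → 0# ≤ y → 0# ≤ x * y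
    1≉0          : ¬ (1# ≈ 0#)
    inv          : ∀ x → ¬ (x ≈ 0#) → Carrier
    *-inverseʳ   : ∀ x (x≉0 : ¬ (x ≈ 0#)) → x * inv x x≉0 ≈ 1#

  totalOrder : TotalOrder c ℓ₁ ℓ₂
  totalOrder = record { isTotalOrder = isTotalOrder }

  open IsTotalOrder isTotalOrder public
    using (antisym; total; ≤-respˡ-≈; ≤-respʳ-≈)
    renaming (refl to ≤-refl; trans to ≤-trans; reflexive to ≤-reflexive)

  open RawSemiringDefs (Semiring.rawSemiring semiring) public
    using (sum) renaming (_×_ to _·_)

  fromℕ : ℕ → Carrier
  fromℕ m = m · 1#

  0≤1 : 0# ≤ 1#
  0≤1 with total 0# 1#
  ... | inj₁ 0≤1 = 0≤1
  ... | inj₂ 1≤0 = ≤-respʳ-≈ -1*-1≈1 (*-nonneg 0≤-1 0≤-1)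
    where
    open RingProperties ring using (-1*x≈-x; -‿involutive)
    0≤-1 : 0# ≤ - 1#
    0≤-1 = ≤-respˡ-≈ (-‿inverseˡ 1#) (≤-respʳ-≈ (+-identityʳ (- 1#)) (+-monoʳ-≤ (- 1#) 1≤0))
    -1*-1≈1 : - 1# * - 1# ≈ 1#
    -1*-1≈1 = trans (-1*x≈-x (- 1#)) (-‿involutive 1#)

  1+1≉0 : ¬ (1# + 1# ≈ 0#)
  1+1≉0 2≈0 = 1≉0 (antisym 1≤0 0≤1)
    where
    1≤0 : 1# ≤ 0#
    1≤0 = ≤-respʳ-≈ 2≈0 (≤-respˡ-≈ (+-identityʳ 1#) (+-monoʳ-≤ 1# 0≤1))

  ½ : Carrier
  ½ = inv (1# + 1#) 1+1≉0

module RobustOptimization {c ℓ₁ ℓ₂ : Level} (𝔽 : OrderedField c ℓ₁ ℓ₂) where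

  open OrderedField 𝔽

  maximum : ∀ {m} → Vector Carrier (ℕ.suc m) → Carrier
  maximum v = Extrema.max totalOrder (head v) (List.tabulate (tail v))

  minimum : ∀ {m} → Vector Carrier (ℕ.suc m) → Carrier
  minimum v = Extrema.min totalOrder (head v) (List.tabulate (tail v))

  sumOver : ∀ {n} → Subset n → Vector Carrier n → Carrier
  sumOver X w = sum (λ i → if does (i ∈? X) then w i else 0#)

  Nonincreasing : ∀ {m} → Vector Carrier m → Set ℓ₂
  Nonincreasing v = ∀ {j k} → j Fin.≤ k → v k ≤ v j

  _IsNonincreasingOrderingOf_ : ∀ {m} → Vector Carrier m → Vector Carrier m → Set (c ⊔ ℓ₂)
  w IsNonincreasingOrderingOf v = (v ↭ w) × Nonincreasing w

  _Minimizes_Over_ : ∀ {n p} → Subset n → (Subset n → Carrier) → Pred (Subset n) p → Set (p ⊔ ℓ₂)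
  X Minimizes f Over Φ = Φ X × (∀ Y → Φ Y → f X ≤ f Y)

  -- The elements e₁,…,eₙ are represented by Fin n, and cost i j is the cost of
  -- element i under scenario j.
  record Problem (n K : ℕ) (p : Level) : Set (c ⊔ ℓ₁ ⊔ ℓ₂ ⊔ lsuc p) where
    field
      Φ             : Pred (Subset n) p
      Φ-nonempty    : Satisfiable Φ
      cost          : Fin n → Fin K → Carrier
      cost-nonneg   : ∀ i j → 0# ≤ cost i j
      cost-distinct : ∀ {j k} → (∀ i → cost i j ≈ cost i k) → j ≡ k

    F : Subset n → Fin K → Carrier
    F X j = sumOver X (λ i → cost i j)

  OWA : ∀ {n m p} → Problem n (ℕ.suc m) p → Carrier → Subset n → Carrier
  OWA P α X = α * maximum (F X) + (1# - α) * minimum (F X)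
    where open Problem P

  aggregatedCost : ∀ {n k} → Carrier → (Fin n → Fin (2 ℕ.+ k) → Carrier) → Fin n → Carrier
  aggregatedCost α sorted i = α * sorted i 0F + (1# - α) * sorted i 1F

{-# OPTIONS --safe #-}

-- Write β = 1 − α, so that 0 ≤ β ≤ α, and Ĉ for the aggregated objective.  Two
-- bounds relate Ĉ to OWA.  Pairing a scenario attaining the maximum with any
-- other scenario gives OWA(X) ≤ Ĉ(X), since α a + β b is largest on two distinct
-- entries a, b of a vector when these are its two largest entries, in order.
-- Conversely Ĉ(X) ≤ α ∑ⱼ F(X, cⱼ) ≤ α (m + (K − 1) M), where m and M are the
-- minimum and maximum of F(X, ·).  Put H = OWA(X) = α M + β m.  As α + β = 1,
-- rearrangement gives m + M = (α m + β M) + H ≤ 2 H, while α M ≤ H; hence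
-- Ĉ(X) ≤ (2 α + (K − 2)) H, and 2 α + (K − 2) is the stated factor.

module Submission where

open import Defs
open import Data.Bool.Base using (true; false; if_then_else_)
open import Data.Fin.Base as Fin using (Fin; punchIn)
open import Data.Fin.Patterns using (0F; 1F)
open import Data.Fin.Permutation using (_⟨$⟩ʳ_; _⟨$⟩ˡ_; inverseʳ)
open import Data.Fin.Properties using (punchInᵢ≢i)
open import Data.Fin.Subset using (Subset)
open import Data.Fin.Subset.Properties using (_∈?_)
open import Data.List.Base as List using ()
open import Data.List.Relation.Unary.All.Properties using (tabulate⁺; tabulate⁻)
open import Data.Nat.Base as ℕ using (ℕ; z≤n; s≤s)
open import Data.Product.Base using (∃; _,_; proj₁; proj₂)
open import Data.Vec.Functional using (Vector; head; tail; removeAt)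
open import Function.Base using (_∘_)
open import Level using (Level)
open import Relation.Binary.Bundles using (Poset)
open import Relation.Binary.PropositionalEquality as ≡ using (_≡_; _≢_)
open import Relation.Nullary.Decidable.Core using (does)
open import Relation.Nullary.Negation.Core using (contradiction)
import Algebra.Properties.CommutativeMonoid.Sum as CommutativeMonoidSum
import Algebra.Properties.Semiring.Sum as SemiringSum
import Algebra.Solver.Ring.NaturalCoefficients.Default as SemiringSolver
import Data.List.Extrema as Extrema
import Relation.Binary.Reasoning.PartialOrder as PartialOrderReasoning

-- Inequalities in a linearly ordered field.

module OrderedFieldProperties {c ℓ₁ ℓ₂ : Level} (𝔽 : OrderedField c ℓ₁ ℓ₂) where

  open OrderedField 𝔽
  open SemiringSolver commutativeSemiring using (solve; _:=_; _:+_; _:*_)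

  poset : Poset c ℓ₁ ℓ₂
  poset = record { isPartialOrder = record
    { isPreorder = record
      { isEquivalence = isEquivalence ; reflexive = ≤-reflexive ; trans = ≤-trans }
    ; antisym = antisym } }

  open PartialOrderReasoning poset

  x+[y-x]≈y : ∀ x y → x + (y - x) ≈ y
  x+[y-x]≈y x y = begin-equality
    x + (y - x)    ≈⟨ solve 3 (λ a b c → a :+ (b :+ c) := b :+ (a :+ c)) refl x y (- x) ⟩
    y + (x - x)    ≈⟨ +-congˡ (-‿inverseʳ x) ⟩
    y + 0#         ≈⟨ +-identityʳ y ⟩
    y              ∎

  +-monoˡ-≤ : ∀ x {y z} → y ≤ z → y + x ≤ z + x
  +-monoˡ-≤ x {y} {z} y≤z = begin
    y + x  ≈⟨ +-comm y x ⟩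
    x + y  ≤⟨ +-monoʳ-≤ x y≤z ⟩
    x + z  ≈⟨ +-comm x z ⟩
    z + x  ∎

  +-mono-≤ : ∀ {x y u v} → x ≤ y → u ≤ v → x + u ≤ y + v
  +-mono-≤ x≤y u≤v = ≤-trans (+-monoˡ-≤ _ x≤y) (+-monoʳ-≤ _ u≤v)

  x≤x+y : ∀ x {y} → 0# ≤ y → x ≤ x + y
  x≤x+y x 0≤y = ≤-respˡ-≈ (+-identityʳ x) (+-monoʳ-≤ x 0≤y)

  +-nonneg : ∀ {x y} → 0# ≤ x → 0# ≤ y → 0# ≤ x + y
  +-nonneg 0≤x 0≤y = ≤-trans 0≤x (x≤x+y _ 0≤y)

  x≤y⇒0≤y-x : ∀ {x y} → x ≤ y → 0# ≤ y - x
  x≤y⇒0≤y-x {x} x≤y = ≤-respˡ-≈ (-‿inverseʳ x) (+-monoˡ-≤ (- x) x≤y)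

  -- The order axiom for products concerns nonnegative factors, so it is applied to `x` and the
  -- difference `z - y`.
  *-monoʳ-≤ : ∀ {x y z} → 0# ≤ x → y ≤ z → x * y ≤ x * z
  *-monoʳ-≤ {x} {y} {z} 0≤x y≤z = begin
    x * y                ≤⟨ x≤x+y (x * y) (*-nonneg 0≤x (x≤y⇒0≤y-x y≤z)) ⟩
    x * y + x * (z - y)  ≈⟨ distribˡ x y (z - y) ⟨
    x * (y + (z - y))    ≈⟨ *-congˡ (x+[y-x]≈y y z) ⟩
    x * z                ∎

  *-monoˡ-≤ : ∀ {x y z} → 0# ≤ x → y ≤ z → y * x ≤ z * x
  *-monoˡ-≤ {x} {y} {z} 0≤x y≤z = begin
    y * x  ≈⟨ *-comm y x ⟩
    x * y  ≤⟨ *-monoʳ-≤ 0≤x y≤z ⟩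
    x * z  ≈⟨ *-comm x z ⟩
    z * x  ∎

  -- Write `a` as `b + d` with `d` nonnegative. The `b` part is symmetric in `x` and `y`, which
  -- leaves `d * y ≤ d * x`.
  rearrangement : ∀ {a b x y} → b ≤ a → y ≤ x → a * y + b * x ≤ a * x + b * y
  rearrangement {a} {b} {x} {y} b≤a y≤x = begin
    a * y + b * x              ≈⟨ split x y ⟩
    d * y + (b * y + b * x)    ≤⟨ +-monoˡ-≤ _ (*-monoʳ-≤ (x≤y⇒0≤y-x b≤a) y≤x) ⟩
    d * x + (b * y + b * x)    ≈⟨ +-congˡ (+-comm (b * y) (b * x)) ⟩
    d * x + (b * x + b * y)    ≈⟨ split y x ⟨
    a * x + b * y              ∎
    where
    d : Carrier
    d = a - b
    split : ∀ u v → a * v + b * u ≈ d * v + (b * v + b * u)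
    split u v = begin-equality
      a * v + b * u              ≈⟨ +-congʳ (*-congʳ (x+[y-x]≈y b a)) ⟨
      (b + d) * v + b * u        ≈⟨ solve 4 (λ b d u v →
          (b :+ d) :* v :+ b :* u := d :* v :+ (b :* v :+ b :* u)) refl b d u v ⟩
      d * v + (b * v + b * u)    ∎

  0≤fromℕ : ∀ n → 0# ≤ fromℕ n
  0≤fromℕ ℕ.zero    = ≤-refl
  0≤fromℕ (ℕ.suc n) = +-nonneg 0≤1 (0≤fromℕ n)

  ½+½≈1 : ½ + ½ ≈ 1#
  ½+½≈1 = begin-equality
    ½ + ½            ≈⟨ +-cong (*-identityˡ ½) (*-identityˡ ½) ⟨
    1# * ½ + 1# * ½  ≈⟨ distribʳ ½ 1# 1# ⟨
    (1# + 1#) * ½    ≈⟨ *-inverseʳ (1# + 1#) 1+1≉0 ⟩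
    1#               ∎

  -- Doubling `½ ≤ x` bounds `1#` by `x + x`. This is how the lower bound on `α` becomes `β ≤ α`.
  ½≤x⇒1-x≤x : ∀ {x} → ½ ≤ x → 1# - x ≤ x
  ½≤x⇒1-x≤x {x} ½≤x = begin
    1# - x         ≈⟨ +-congʳ ½+½≈1 ⟨
    ½ + ½ - x      ≤⟨ +-monoˡ-≤ (- x) (+-mono-≤ ½≤x ½≤x) ⟩
    x + x - x      ≈⟨ +-assoc x x (- x) ⟩
    x + (x - x)    ≈⟨ x+[y-x]≈y x x ⟩
    x              ∎

  -- Bounds on finite sums.

  sum-mono-≤ : ∀ {n} {u v : Vector Carrier n} → (∀ i → u i ≤ v i) → sum u ≤ sum v
  sum-mono-≤ {ℕ.zero}  u≤v = ≤-refl
  sum-mono-≤ {ℕ.suc n} u≤v = +-mono-≤ (u≤v 0F) (sum-mono-≤ (u≤v ∘ Fin.suc))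

  sum-nonneg : ∀ {n} {v : Vector Carrier n} → (∀ i → 0# ≤ v i) → 0# ≤ sum v
  sum-nonneg {ℕ.zero}  0≤v = ≤-refl
  sum-nonneg {ℕ.suc n} 0≤v = +-nonneg (0≤v 0F) (sum-nonneg (0≤v ∘ Fin.suc))

  sum≤fromℕ* : ∀ {n} {v : Vector Carrier n} {x} → (∀ i → v i ≤ x) → sum v ≤ fromℕ n * x
  sum≤fromℕ* {ℕ.zero}  {x = x} v≤x = ≤-reflexive (sym (zeroˡ x))
  sum≤fromℕ* {ℕ.suc n} {v} {x} v≤x = begin
    sum v                  ≤⟨ +-mono-≤ (v≤x 0F) (sum≤fromℕ* (v≤x ∘ Fin.suc)) ⟩
    x + fromℕ n * x        ≈⟨ +-congʳ (*-identityˡ x) ⟨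
    1# * x + fromℕ n * x   ≈⟨ distribʳ x 1# (fromℕ n) ⟨
    fromℕ (ℕ.suc n) * x    ∎

module RobustOptimizationProperties {c ℓ₁ ℓ₂ : Level} (𝔽 : OrderedField c ℓ₁ ℓ₂) where

  open OrderedField 𝔽
  open RobustOptimization 𝔽
  open OrderedFieldProperties 𝔽
  open CommutativeMonoidSum +-commutativeMonoid
    using (sum-cong-≋; sum-cong-≗; sum-replicate-zero; sum-remove; sum-permute; ∑-distrib-+; ∑-comm)
  open SemiringSum semiring using (*-distribˡ-sum)
  open SemiringSolver commutativeSemiring using (solve; _:=_; _:+_; _:*_)
  open PartialOrderReasoning poset

  -- Extreme entries of a vector.

  ≤maximum : ∀ {m} (v : Vector Carrier (ℕ.suc m)) j → v j ≤ maximum v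
  ≤maximum v 0F          = Extrema.⊥≤max totalOrder (head v) (List.tabulate (tail v))
  ≤maximum v (Fin.suc j) =
    tabulate⁻ (Extrema.xs≤max totalOrder (head v) (List.tabulate (tail v))) j

  minimum≤ : ∀ {m} (v : Vector Carrier (ℕ.suc m)) j → minimum v ≤ v j
  minimum≤ v 0F          = Extrema.min≤⊤ totalOrder (head v) (List.tabulate (tail v))
  minimum≤ v (Fin.suc j) =
    tabulate⁻ (Extrema.min≤xs totalOrder (head v) (List.tabulate (tail v))) j

  -- `argmax-all` passes a property shared by all candidates on to the selected one; the property
  -- chosen is that of equalling some entry of `v`.
  maximum-attained : ∀ {m} (v : Vector Carrier (ℕ.suc m)) → ∃ λ j → maximum v ≡ v j
  maximum-attained v = Extrema.argmax-all totalOrder (λ x → x)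
    {P = λ x → ∃ λ j → x ≡ v j} (0F , ≡.refl) (tabulate⁺ λ j → Fin.suc j , ≡.refl)

  minimum-attained : ∀ {m} (v : Vector Carrier (ℕ.suc m)) → ∃ λ j → minimum v ≡ v j
  minimum-attained v = Extrema.argmin-all totalOrder (λ x → x)
    {P = λ x → ∃ λ j → x ≡ v j} (0F , ≡.refl) (tabulate⁺ λ j → Fin.suc j , ≡.refl)

  -- Split off one entry attaining the minimum; each of the `m` others is at most the maximum.
  sum≤minimum+fromℕ*maximum : ∀ {m} (v : Vector Carrier (ℕ.suc m)) →
                              sum v ≤ minimum v + fromℕ m * maximum v
  sum≤minimum+fromℕ*maximum {m} v with minimum-attained v
  ... | j , min≡vj = begin
    sum v                              ≈⟨ sum-remove {i = j} v ⟩
    v j + sum (removeAt v j)           ≡⟨ ≡.cong (_+ sum (removeAt v j)) min≡vj ⟨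
    minimum v + sum (removeAt v j)     ≤⟨ +-monoʳ-≤ (minimum v)
                                            (sum≤fromℕ* (λ i → ≤maximum v (punchIn j i))) ⟩
    minimum v + fromℕ m * maximum v    ∎

  -- Sums over a subset.

  private
    if-mono : ∀ b {x y} → x ≤ y → (if b then x else 0#) ≤ (if b then y else 0#)
    if-mono true  x≤y = x≤y
    if-mono false _   = ≤-refl

    if-nonneg : ∀ b {x} → 0# ≤ x → 0# ≤ (if b then x else 0#)
    if-nonneg true  0≤x = 0≤x
    if-nonneg false _   = ≤-refl

    if-+ : ∀ b x y → (if b then x else 0#) + (if b then y else 0#) ≈ (if b then x + y else 0#)
    if-+ true  x y = refl
    if-+ false x y = +-identityˡ 0#

    if-* : ∀ b z x → z * (if b then x else 0#) ≈ (if b then z * x else 0#)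
    if-* true  z x = refl
    if-* false z x = zeroʳ z

    if-sum : ∀ b {n} (v : Vector Carrier n) →
             (if b then sum v else 0#) ≈ sum (λ j → if b then v j else 0#)
    if-sum true  v     = refl
    if-sum false {n} v = sym (sum-replicate-zero n)

  module _ {n} (X : Subset n) where

    sumOver-mono-≤ : ∀ {u v : Vector Carrier n} → (∀ i → u i ≤ v i) → sumOver X u ≤ sumOver X v
    sumOver-mono-≤ u≤v = sum-mono-≤ (λ i → if-mono (does (i ∈? X)) (u≤v i))

    sumOver-nonneg : ∀ {v : Vector Carrier n} → (∀ i → 0# ≤ v i) → 0# ≤ sumOver X v
    sumOver-nonneg 0≤v = sum-nonneg (λ i → if-nonneg (does (i ∈? X)) (0≤v i))

    sumOver-+ : ∀ (u v : Vector Carrier n) →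
                sumOver X u + sumOver X v ≈ sumOver X (λ i → u i + v i)
    sumOver-+ u v = trans (sym (∑-distrib-+ {n} _ _))
      (sum-cong-≋ {n} (λ i → if-+ (does (i ∈? X)) (u i) (v i)))

    sumOver-* : ∀ z (v : Vector Carrier n) → z * sumOver X v ≈ sumOver X (λ i → z * v i)
    sumOver-* z v = trans (*-distribˡ-sum {n} z _)
      (sum-cong-≋ {n} (λ i → if-* (does (i ∈? X)) z (v i)))

    -- Exchanging the two summations turns total costs per element into solution costs per scenario.
    sumOver-sum : ∀ {m} (f : Fin n → Fin m → Carrier) →
                  sumOver X (λ i → sum (f i)) ≈ sum (λ j → sumOver X (λ i → f i j))
    sumOver-sum {m} f = trans (sum-cong-≋ {n} (λ i → if-sum (does (i ∈? X)) (f i)))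
      (∑-comm {n} {m} (λ i j → if does (i ∈? X) then f i j else 0#))

  -- Nonincreasing rearrangements.

  module NonincreasingOrdering {m} (v w : Vector Carrier m)
                               (w-sorts-v : w IsNonincreasingOrderingOf v) where

    private
      ρ    = proj₁ (proj₁ w-sorts-v)
      vρ≡w = proj₂ (proj₁ w-sorts-v)

    -- `ρ` sends positions in `w` to indices of `v`, so its inverse locates an entry of `v` in the
    -- sorted vector.
    rank : Fin m → Fin m
    rank = ρ ⟨$⟩ˡ_

    rank-injective : ∀ {i j} → rank i ≡ rank j → i ≡ j
    rank-injective eq = ≡.trans (≡.sym (inverseʳ ρ)) (≡.trans (≡.cong (ρ ⟨$⟩ʳ_) eq) (inverseʳ ρ))

    ordering-rank : ∀ i → v i ≡ w (rank i)
    ordering-rank i = ≡.trans (≡.cong v (≡.sym (inverseʳ ρ))) (vρ≡w (rank i))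

    ordering-nonneg : (∀ i → 0# ≤ v i) → ∀ i → 0# ≤ w i
    ordering-nonneg 0≤v i = ≡.subst (0# ≤_) (vρ≡w i) (0≤v (ρ ⟨$⟩ʳ i))

    ordering-sum : sum v ≈ sum w
    ordering-sum = trans (sum-permute v ρ) (reflexive (sum-cong-≗ {m} vρ≡w))

  -- Weighted pairs and the approximation factor.

  pair≤top-pair : ∀ {k} {a b} {w : Vector Carrier (2 ℕ.+ k)} → 0# ≤ b → b ≤ a → Nonincreasing w →
                  ∀ {r s} → r ≢ s → a * w r + b * w s ≤ a * w 0F + b * w 1F
  pair≤top-pair 0≤b b≤a w↘ {0F}        {0F}        r≢s = contradiction ≡.refl r≢s
  pair≤top-pair 0≤b b≤a w↘ {0F}        {Fin.suc s} r≢s =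
    +-monoʳ-≤ _ (*-monoʳ-≤ 0≤b (w↘ (s≤s z≤n)))
  -- With the first index positive, its entry is at most `w 1F` and the other at most `w 0F`. This
  -- gives the top pair in the wrong order, which rearrangement corrects.
  pair≤top-pair {a = a} {b} {w} 0≤b b≤a w↘ {Fin.suc r} {s} r≢s = begin
    a * w (Fin.suc r) + b * w s  ≤⟨ +-mono-≤ (*-monoʳ-≤ (≤-trans 0≤b b≤a) (w↘ (s≤s z≤n)))
                                             (*-monoʳ-≤ 0≤b (w↘ z≤n)) ⟩
    a * w 1F + b * w 0F          ≤⟨ rearrangement b≤a (w↘ z≤n) ⟩
    a * w 0F + b * w 1F          ∎

  -- Here `κ` stands for K - 2. One copy of `M` joins `m`, with sum at most `H + H`; each of the `κ`
  -- other copies contributes `α * M`, at most `H`.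
  hurwicz-factor : ∀ {α β m M κ} → α + β ≈ 1# → 0# ≤ β → β ≤ α → 0# ≤ κ → 0# ≤ m → m ≤ M →
                   α * (m + (1# + κ) * M) ≤ (α * (1# + (1# + κ)) + β * κ) * (α * M + β * m)
  hurwicz-factor {α} {β} {m} {M} {κ} α+β≈1 0≤β β≤α 0≤κ 0≤m m≤M = begin
    α * (m + (1# + κ) * M)
      -- The solver treats `1#` as a variable `u`, so explicit factors `1#` are inserted to make the
      -- identity hold for every `u`.
      ≈⟨ *-congˡ (+-congʳ (*-identityˡ m)) ⟨
    α * (1# * m + (1# + κ) * M)
      ≈⟨ solve 5 (λ α m M κ u → α :* (u :* m :+ (u :+ κ) :* M)
                             := α :* (u :* (m :+ M)) :+ κ :* (α :* M)) refl α m M κ 1# ⟩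
    α * (1# * (m + M)) + κ * (α * M)
      ≤⟨ +-mono-≤ (*-monoʳ-≤ 0≤α m+M≤2H) (*-monoʳ-≤ 0≤κ (x≤x+y _ (*-nonneg 0≤β 0≤m))) ⟩
    α * (H + H) + κ * H
      ≈⟨ +-cong (*-congˡ (+-cong (*-identityˡ H) (*-identityˡ H))) (*-identityˡ (κ * H)) ⟨
    α * (1# * H + 1# * H) + 1# * (κ * H)
      -- Splitting the coefficient of `κ * H` into `α + β` produces the separate `α` and `β` terms
      -- of the factor.
      ≈⟨ +-congˡ (*-congʳ α+β≈1) ⟨
    α * (1# * H + 1# * H) + (α + β) * (κ * H)
      ≈⟨ solve 5 (λ α β κ H u → α :* (u :* H :+ u :* H) :+ (α :+ β) :* (κ :* H)
                             := (α :* (u :+ (u :+ κ)) :+ β :* κ) :* H) refl α β κ H 1# ⟩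
    (α * (1# + (1# + κ)) + β * κ) * H ∎
    where
    H : Carrier
    H = α * M + β * m
    0≤α : 0# ≤ α
    0≤α = ≤-trans 0≤β β≤α
    m+M≤2H : 1# * (m + M) ≤ H + H
    m+M≤2H = begin
      1# * (m + M)             ≈⟨ *-congʳ α+β≈1 ⟨
      (α + β) * (m + M)        ≈⟨ solve 4 (λ α β m M → (α :+ β) :* (m :+ M)
                                   := (α :* m :+ β :* M) :+ (α :* M :+ β :* m)) refl α β m M ⟩
      (α * m + β * M) + H      ≤⟨ +-monoˡ-≤ H (rearrangement β≤α m≤M) ⟩
      H + H                    ∎

  -- Comparing the Hurwicz criterion with the aggregated objective.

  module _ {n k p} (P : Problem n (2 ℕ.+ k) p) {α} (½≤α : ½ ≤ α) (α≤1 : α ≤ 1#)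
           {ĉ : Fin n → Fin (2 ℕ.+ k) → Carrier}
           (ĉ-sorts : ∀ i → ĉ i IsNonincreasingOrderingOf Problem.cost P i) where

    open Problem P

    private
      β : Carrier
      β = 1# - α

      0≤β : 0# ≤ β
      0≤β = x≤y⇒0≤y-x α≤1

      β≤α : β ≤ α
      β≤α = ½≤x⇒1-x≤x ½≤α

      0≤α : 0# ≤ α
      0≤α = ≤-trans 0≤β β≤α

    OWA≤aggregated : ∀ X → OWA P α X ≤ sumOver X (aggregatedCost α ĉ)
    OWA≤aggregated X with maximum-attained (F X)
    ... | j , max≡Fj = begin
      α * maximum (F X) + β * minimum (F X)
        ≤⟨ +-mono-≤ (≤-reflexive (*-congˡ (reflexive max≡Fj))) (*-monoʳ-≤ 0≤β (minimum≤ (F X) l)) ⟩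
      α * F X j + β * F X l
        ≈⟨ +-cong (sumOver-* X α _) (sumOver-* X β _) ⟩
      sumOver X (λ i → α * cost i j) + sumOver X (λ i → β * cost i l)
        ≈⟨ sumOver-+ X _ _ ⟩
      sumOver X (λ i → α * cost i j + β * cost i l)
        ≤⟨ sumOver-mono-≤ X element ⟩
      sumOver X (aggregatedCost α ĉ) ∎
      where
      -- A scenario attaining the minimum might be `j` itself. The minimum is at most the cost in
      -- every scenario, so any `l` distinct from `j` serves.
      l : Fin (2 ℕ.+ k)
      l = punchIn j 0F
      element : ∀ i → α * cost i j + β * cost i l ≤ aggregatedCost α ĉ i
      element i = begin
        α * cost i j + β * cost i l
          ≡⟨ ≡.cong₂ (λ x y → α * x + β * y) (ordering-rank j) (ordering-rank l) ⟩
        α * ĉ i (rank j) + β * ĉ i (rank l)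
          ≤⟨ pair≤top-pair 0≤β β≤α (proj₂ (ĉ-sorts i))
               (punchInᵢ≢i j 0F ∘ ≡.sym ∘ rank-injective) ⟩
        aggregatedCost α ĉ i ∎
        where
        open NonincreasingOrdering (cost i) (ĉ i) (ĉ-sorts i)

    aggregated≤factor*OWA : ∀ X →
      sumOver X (aggregatedCost α ĉ)
        ≤ (α * fromℕ (2 ℕ.+ k) + β * (fromℕ (2 ℕ.+ k) - fromℕ 2)) * OWA P α X
    aggregated≤factor*OWA X = begin
      sumOver X (aggregatedCost α ĉ)
        ≤⟨ sumOver-mono-≤ X element ⟩
      sumOver X (λ i → α * sum (cost i))
        ≈⟨ sumOver-* X α _ ⟨
      α * sumOver X (λ i → sum (cost i))
        ≈⟨ *-congˡ (sumOver-sum X cost) ⟩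
      α * sum (F X)
        ≤⟨ *-monoʳ-≤ 0≤α (sum≤minimum+fromℕ*maximum (F X)) ⟩
      α * (minimum (F X) + fromℕ (1 ℕ.+ k) * maximum (F X))
        -- Taken with `κ = fromℕ k`: `fromℕ (1 ℕ.+ k)` and `fromℕ (2 ℕ.+ k)` unfold to `1# + κ` and
        -- `1# + (1# + κ)`.
        ≤⟨ hurwicz-factor (x+[y-x]≈y α 1#) 0≤β β≤α (0≤fromℕ k) 0≤min min≤max ⟩
      (α * fromℕ (2 ℕ.+ k) + β * fromℕ k) * OWA P α X
        ≈⟨ *-congʳ (+-congˡ (*-congˡ K-2≈k)) ⟨
      (α * fromℕ (2 ℕ.+ k) + β * (fromℕ (2 ℕ.+ k) - fromℕ 2)) * OWA P α X ∎
      where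
      element : ∀ i → aggregatedCost α ĉ i ≤ α * sum (cost i)
      element i = begin
        α * ĉ i 0F + β * ĉ i 1F   ≤⟨ +-monoʳ-≤ _ (*-monoˡ-≤ (0≤ĉ 1F) β≤α) ⟩
        α * ĉ i 0F + α * ĉ i 1F   ≈⟨ distribˡ α _ _ ⟨
        -- `sum (ĉ i)` unfolds to the two top entries followed by a nonnegative tail.
        α * (ĉ i 0F + ĉ i 1F)     ≤⟨ *-monoʳ-≤ 0≤α (+-monoʳ-≤ _ (x≤x+y _
                                       (sum-nonneg (λ r → 0≤ĉ (Fin.suc (Fin.suc r)))))) ⟩
        α * sum (ĉ i)             ≈⟨ *-congˡ ordering-sum ⟨
        α * sum (cost i)          ∎
        where
        open NonincreasingOrdering (cost i) (ĉ i) (ĉ-sorts i)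
        0≤ĉ : ∀ r → 0# ≤ ĉ i r
        0≤ĉ = ordering-nonneg (cost-nonneg i)
      0≤min : 0# ≤ minimum (F X)
      0≤min with minimum-attained (F X)
      ... | j , min≡Fj = ≡.subst (0# ≤_) (≡.sym min≡Fj) (sumOver-nonneg X (λ i → cost-nonneg i j))
      min≤max : minimum (F X) ≤ maximum (F X)
      min≤max = ≤-trans (minimum≤ (F X) 0F) (≤maximum (F X) 0F)
      K-2≈k : fromℕ (2 ℕ.+ k) - fromℕ 2 ≈ fromℕ k
      K-2≈k = begin-equality
        (1# + (1# + fromℕ k)) - fromℕ 2         ≈⟨ +-congʳ (+-assoc 1# 1# (fromℕ k)) ⟨
        -- `fromℕ 2` unfolds to `1# + (1# + 0#)`, hence the restored `0#`.
        ((1# + 1#) + fromℕ k) - fromℕ 2         ≈⟨ +-congʳ (+-congʳ (+-congˡ (+-identityʳ 1#))) ⟨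
        (fromℕ 2 + fromℕ k) - fromℕ 2           ≈⟨ +-assoc (fromℕ 2) (fromℕ k) (- fromℕ 2) ⟩
        fromℕ 2 + (fromℕ k - fromℕ 2)           ≈⟨ x+[y-x]≈y (fromℕ 2) (fromℕ k) ⟩
        fromℕ k                                 ∎

theorem7 : ∀ {c ℓ₁ ℓ₂ p : Level} (𝔽 : OrderedField c ℓ₁ ℓ₂) (n k : ℕ) →
    let open OrderedField 𝔽
        open RobustOptimization 𝔽
        K = 2 ℕ.+ k
    in (P : Problem n K p) →
    let open Problem P
    in (α : Carrier) → ½ ≤ α → α ≤ 1# →
       (ĉ : Fin n → Fin K → Carrier) →
       (∀ i → ĉ i IsNonincreasingOrderingOf cost i) →
       (X̂ : Subset n) →
       X̂ Minimizes (λ X → sumOver X (aggregatedCost α ĉ)) Over Φ →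
       (X : Subset n) → Φ X →
       OWA P α X̂ ≤ (α * fromℕ K + (1# - α) * (fromℕ K - fromℕ 2)) * OWA P α X
theorem7 𝔽 n k P α ½≤α α≤1 ĉ ĉ-sorts X̂ (_ , X̂-minimal) X X∈Φ =
  -- Minimality of `X̂` links the two bounds, the first taken at `X̂` and the second at `X`.
  ≤-trans (OWA≤aggregated P ½≤α α≤1 ĉ-sorts X̂)
    (≤-trans (X̂-minimal X X∈Φ) (aggregated≤factor*OWA P ½≤α α≤1 ĉ-sorts X))
  where
  open OrderedField 𝔽 using (≤-trans)
  open RobustOptimizationProperties 𝔽 using (OWA≤aggregated; aggregated≤factor*OWA)
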